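{- For all integers $n\ge 1$ and $1\le r\le n$, there exists a deterministic online algorithm for $r$-uniform Online Min-Sum Set Cover on a universe of $n$ elements that is $(5r+2)$-competitive against the static optimum.
   Context: Let $U$ be a set of $n$ elements. A permutation $\pi$ of $U$ assigns each element $e$ a position $\pi[e]\in\{1,\dots,n\}$. For nonempty $S\subseteq U$, the access cost is $\pi(S)=\min_{e\in S}\pi[e]$. The Kendall tau distance $d_{KT}(\pi,\sigma)$ is the number of unordered pairs of elements ordered differently by $\pi$ and $\sigma$. In $r$-uniform Online Min-Sum Set Cover, an initial permutation $\pi_0$ is given and request sets $S_1,\dots,S_m\subseteq U$ with $|S_t|=r$ arrive one by one. When $S_t$ arrives, the algorithm, holding $\pi_{t-1}$, pays access cost $\pi_{t-1}(S_t)$ and then chooses $\pi_t$ (depending only on $\pi_0,S_1,\dots,S_t$), paying moving cost $d_{KT}(\pi_{t-1},\pi_t)$. The algorithm's cost is total access plus moving cost. The static optimum is $\mathrm{OPT}=\min_{\pi}\sum_{t=1}^m\pi(S_t)$. An online algorithm is $c$-competitive if there is a constant $\alpha$ (independent of the request sequence, possibly depending on $n,r$) such that its cost is at most $c\cdot\mathrm{OPT}+\alpha$ for every initial permutation and request sequence. -}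

module Defs where

open import Data.Nat using (ℕ; zero; suc; _+_; _*_; _⊓_; _<ᵇ_)
open import Data.Bool using (Bool; true; false; if_then_else_; _xor_)
open import Data.Fin using (Fin; toℕ)
open import Data.Fin.Subset using (Subset; ∣_∣)
open import Data.Vec using (lookup)
open import Data.Fin.Permutation using (Permutation′; _⟨$⟩ʳ_)
open import Data.List using (List; []; _∷_; _++_; [_]; map; allFin)
open import Data.Nat.ListAction using (sum)
open import Data.Product using (Σ; _,_; proj₁)
open import Relation.Binary.PropositionalEquality using (_≡_)

-- The universe U is Fin n.  A permutation π assigns element e the
-- position  π[e] = 1 + toℕ (π ⟨$⟩ʳ e)  ∈ {1,…,n}.
Perm : ℕ → Set
Perm n = Permutation′ n

pos : ∀ {n} → Perm n → Fin n → ℕ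
pos π e = suc (toℕ (π ⟨$⟩ʳ e))

-- Access cost π(S) = min_{e ∈ S} π[e].  The fold starts from n, which is
-- ≥ every position, so for nonempty S this is exactly the minimum.
access : ∀ {n} → Perm n → Subset n → ℕ
access {n} π S = go (allFin n)
  where
  go : List (Fin _) → ℕ
  go [] = n
  go (e ∷ es) = if lookup S e then pos π e ⊓ go es else go es

dKT : ∀ {n} → Perm n → Perm n → ℕ
dKT {n} π σ = sum (map (λ i → sum (map (λ j → cnt i j) (allFin n))) (allFin n))
  where
  cnt : Fin n → Fin n → ℕ
  cnt i j = if toℕ i <ᵇ toℕ j
              then (if (pos π i <ᵇ pos π j) xor (pos σ i <ᵇ pos σ j) then 1 else 0)
              else 0

Request : ℕ → ℕ → Set
Request n r = Σ (Subset n) (λ S → ∣ S ∣ ≡ r)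

-- A deterministic online algorithm: given the initial permutation π₀ and
-- the requests S₁,…,S_t seen so far (chronological order), it outputs π_t.
OnlineAlg : ℕ → ℕ → Set
OnlineAlg n r = Perm n → List (Request n r) → Perm n

algCost : ∀ {n r} → OnlineAlg n r → Perm n → List (Request n r) → ℕ
algCost {n} {r} A π₀ reqs = run π₀ [] reqs
  where
  run : Perm n → List (Request n r) → List (Request n r) → ℕ
  run cur hist [] = 0
  run cur hist (S ∷ rest) =
    let hist′ = hist ++ [ S ]
        nxt   = A π₀ hist′
    in access cur (proj₁ S) + dKT cur nxt + run nxt hist′ rest

staticCost : ∀ {n r} → Perm n → List (Request n r) → ℕ
staticCost π reqs = sum (map (λ S → access π (proj₁ S)) reqs)

{-# OPTIONS --safe #-}
module Submission where

-- Multiplicative weights over all permutations, reweighted once per block of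
-- n² + 1 requests.  For weights w, list the r-sets by increasing weighted access
-- cost, keep greedily those disjoint from the earlier ones, and place the kept
-- sets one after another: this is the permutation ρ used during the next block.
-- If S meets the k-th kept set then ρ(S) ≤ rk, while the first k kept sets are
-- disjoint, so that every permutation pays at least k(k+1)/2 for them, and they
-- cost at most as much as S on average; hence ρ(S) is at most 2r times the
-- weighted average of π(S).  Multiplying weights by 1 - 2rℓ/K for a block loss ℓ,
-- K large, costs another factor 2, which gives 4r for the access cost.  A block
-- moves at most n² and every request costs OPT at least 1, which adds 1.
-- Logarithms are avoided by comparing powers of K and K + 1.

open import Defs
open import Data.Nat using (ℕ; _+_; _*_; _≤_)
open import Data.List using (List)
open import Data.Product using (Σ)

import Algebra.Properties.Semiring.Sum
open import Data.Bool using (T; true; false; if_then_else_; _xor_)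
open import Data.Fin as Fin using (Fin; zero; suc; toℕ; fromℕ<; punchIn; combine; inject≤; finToFun; funToFin)
import Data.Fin.Properties as Fin
open import Data.Fin.Permutation as Perm using (permutation; _⟨$⟩ʳ_; inverseˡ)
open import Data.Fin.Subset using (Subset; inside; outside; _∈_; _∪_; ⊥; ⊤; ∣_∣; Nonempty)
open import Data.Fin.Subset.Properties using
  (_∈?_; nonempty?; Empty-unique; ∣⊥∣≡0; ∣⊤∣≡n; ∈⊤; ∉⊥; p⊂q⇒∣p∣<∣q∣; x∈p∪q⁺; x∈p∪q⁻)
open import Data.List using ([]; _∷_; [_]; _++_; allFin; foldl; length; lookup; map)
open import Data.List.Membership.Propositional renaming (_∈_ to _∈ᴸ_) using ()
open import Data.List.Membership.Propositional.Properties using (∈-allFin; ∈-lookup; ∈-map⁺; ∈-++⁺ˡ; ∈-++⁺ʳ)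
open import Data.List.Properties using (length-tabulate; foldl-∷ʳ)
open import Data.List.Relation.Binary.Permutation.Propositional using (↭-sym)
open import Data.List.Relation.Binary.Permutation.Propositional.Properties using (∈-resp-↭)
open import Data.List.Relation.Unary.All as All using (All; []; _∷_)
open import Data.List.Relation.Unary.AllPairs using (AllPairs; []; _∷_)
open import Data.List.Relation.Unary.Any as Any using (Any; here; there)
open import Data.List.Relation.Unary.Any.Properties using (lookup-index)
open import Data.List.Relation.Unary.Linked.Properties using (Linked⇒AllPairs)
import Data.List.Sort
open import Data.Nat using (zero; suc; pred; _∸_; _^_; _<_; _<ᵇ_; _≤?_; z≤n; s≤s; s≤s⁻¹; NonZero; >-nonZero)
import Data.Nat.ListAction as List
open import Data.Nat.Properties
open import Data.Nat.Tactic.RingSolver using (solve-∀)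
open import Data.Product using (∃; _×_; _,_; proj₁; proj₂)
open import Data.Sum using (_⊎_; inj₁; inj₂)
import Data.Vec as Vec
open import Data.Vec.Properties using ([]=⇒lookup; lookup⇒[]=; lookup∘tabulate)
open import Function using (_∘_; id; _on_)
open import Function.Definitions using (Injective)
import Relation.Binary.Construct.On as On
open import Relation.Binary.Definitions using (tri<; tri≈; tri>)
open import Relation.Binary.PropositionalEquality using (_≡_; _≢_; _≗_; refl; sym; trans; cong; cong₂; subst)
open import Relation.Nullary using (Dec; yes; no; does; ¬_; contradiction)
open import Relation.Nullary.Decidable using (_×-dec_; _→-dec_; dec-true)

open ≤-Reasoning

module ∑ = Algebra.Properties.Semiring.Sum +-*-semiring
open ∑ using (sum)

-- The local functions of Defs have no name outside it; a
-- meta-variable solved by unification gives them one.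
mutual
  accessFrom : ∀ {n} → Perm n → Subset n → List (Fin n) → ℕ
  accessFrom = _

  access≡accessFrom : ∀ {n} (π : Perm n) S → access π S ≡ accessFrom π S (allFin n)
  access≡accessFrom {n} π S with allFin n
  ... | es = refl

mutual
  pairCost : ∀ {n} → Perm n → Perm n → Fin n → Fin n → ℕ
  pairCost = _

  dKT≡pairCost : ∀ {n} (π σ : Perm n) →
    dKT π σ ≡ List.sum (map (λ i → List.sum (map (pairCost π σ i) (allFin n))) (allFin n))
  dKT≡pairCost π σ = refl

mutual
  run : ∀ {n r} → OnlineAlg n r → Perm n → List (Request n r) →
        Perm n → List (Request n r) → List (Request n r) → ℕ
  run = _

  algCost-∷ : ∀ {n r} (A : OnlineAlg n r) π₀ S rest → algCost A π₀ (S ∷ rest) ≡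
    access π₀ (proj₁ S) + dKT π₀ (A π₀ [ S ]) + run A π₀ (S ∷ rest) (A π₀ [ S ]) [ S ] rest
  algCost-∷ A π₀ S rest with A π₀ [ S ]
  ... | cur with [ S ] | S ∷ rest
  ... | hist | reqs = refl

-- Access cost and Kendall tau distance

accessFrom≤pos : ∀ {n} (π : Perm n) S {e es} → e ∈ S → e ∈ᴸ es → accessFrom π S es ≤ pos π e
accessFrom≤pos π S e∈S (here refl) rewrite []=⇒lookup e∈S = m⊓n≤m _ _
accessFrom≤pos π S {es = x ∷ es} e∈S (there e∈es) with Vec.lookup S x
... | true  = ≤-trans (m⊓n≤n (pos π x) _) (accessFrom≤pos π S e∈S e∈es)
... | false = accessFrom≤pos π S e∈S e∈es

accessFrom-attained : ∀ {n} (π : Perm n) S es →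
  accessFrom π S es ≡ n ⊎ ∃ λ e → e ∈ S × accessFrom π S es ≡ pos π e
accessFrom-attained π S [] = inj₁ refl
accessFrom-attained π S (x ∷ es) with Vec.lookup S x in x∈S
... | false = accessFrom-attained π S es
... | true with ⊓-sel (pos π x) (accessFrom π S es) | accessFrom-attained π S es
...   | inj₁ ≡pos | _                     = inj₂ (x , lookup⇒[]= x S x∈S , ≡pos)
...   | inj₂ ≡rec | inj₁ ≡n               = inj₁ (trans ≡rec ≡n)
...   | inj₂ ≡rec | inj₂ (e , e∈S , ≡pos) = inj₂ (e , e∈S , trans ≡rec ≡pos)

access≤pos : ∀ {n} (π : Perm n) {S e} → e ∈ S → access π S ≤ pos π e
access≤pos π {S} {e} e∈S rewrite access≡accessFrom π S = accessFrom≤pos π S e∈S (∈-allFin e)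

pos≤n : ∀ {n} (π : Perm n) e → pos π e ≤ n
pos≤n π e = Fin.toℕ<n (π ⟨$⟩ʳ e)

access-attained : ∀ {n} (π : Perm n) {S} → Nonempty S → ∃ λ e → e ∈ S × access π S ≡ pos π e
access-attained {n} π {S} (e , e∈S) with accessFrom-attained π S (allFin n)
... | inj₂ attained rewrite access≡accessFrom π S = attained
-- If the fold returns its default value n, every element of `S` has position at least n, hence
-- exactly n, so the given `e` attains the minimum.
... | inj₁ ≡n = e , e∈S , ≤-antisym (access≤pos π e∈S)
      (≤-trans (pos≤n π e) (≤-reflexive (sym (trans (access≡accessFrom π S) ≡n))))

access≤n : ∀ {n} (π : Perm n) {S} → Nonempty S → access π S ≤ n
access≤n π (e , e∈S) = ≤-trans (access≤pos π e∈S) (pos≤n π e)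

access≥1 : ∀ {n} (π : Perm n) {S} → Nonempty S → 1 ≤ access π S
access≥1 π ne with e , _ , ≡pos ← access-attained π ne = ≤-trans (s≤s z≤n) (≤-reflexive (sym ≡pos))

access-mono : ∀ {n} (π σ : Perm n) {S} → (∀ e → pos π e ≤ pos σ e) → Nonempty S →
  access π S ≤ access σ S
access-mono π σ {S} π≤σ ne with e , e∈S , ≡pos ← access-attained σ ne = begin
  access π S ≤⟨ access≤pos π e∈S ⟩
  pos π e    ≤⟨ π≤σ e ⟩
  pos σ e    ≡⟨ ≡pos ⟨
  access σ S ∎

sum-map-≤ : ∀ {A : Set} (f : A → ℕ) c → (∀ x → f x ≤ c) → ∀ xs → List.sum (map f xs) ≤ length xs * c
sum-map-≤ f c f≤c []       = z≤n
sum-map-≤ f c f≤c (x ∷ xs) = +-mono-≤ (f≤c x) (sum-map-≤ f c f≤c xs)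

-- Taken with c = 1 to bound any move by n², and with c = 0 for a permutation and itself.
dKT≤ : ∀ {n} (π σ : Perm n) c → (∀ i j → pairCost π σ i j ≤ c) → dKT π σ ≤ n * (n * c)
dKT≤ {n} π σ c pair≤c = begin
  dKT π σ                                ≡⟨ dKT≡pairCost π σ ⟩
  _                                      ≤⟨ sum-map-≤ _ _ (λ i → sum-map-≤ (pairCost π σ i) c (pair≤c i) (allFin n)) (allFin n) ⟩
  length (allFin n) * (length (allFin n) * c) ≡⟨ cong (λ m → m * (m * c)) (length-tabulate {n = n} id) ⟩
  n * (n * c)                            ∎

dKT≤n*n : ∀ {n} (π σ : Perm n) → dKT π σ ≤ n * n
dKT≤n*n {n} π σ = subst (dKT π σ ≤_) (cong (n *_) (*-identityʳ n)) (dKT≤ π σ 1 pair≤1)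
  where
  pair≤1 : ∀ i j → pairCost π σ i j ≤ 1
  pair≤1 i j with toℕ i <ᵇ toℕ j
  ... | false = z≤n
  ... | true with (pos π i <ᵇ pos π j) xor (pos σ i <ᵇ pos σ j)
  ...   | false = z≤n
  ...   | true  = ≤-refl

dKT-refl : ∀ {n} (π : Perm n) → dKT π π ≡ 0
dKT-refl {n} π = n≤0⇒n≡0 (subst (dKT π π ≤_) (trans (cong (n *_) (*-zeroʳ n)) (*-zeroʳ n)) (dKT≤ π π 0 pair≤0))
  where
  pair≤0 : ∀ i j → pairCost π π i j ≤ 0
  pair≤0 i j with toℕ i <ᵇ toℕ j | pos π i <ᵇ pos π j
  ... | false | _     = z≤n
  ... | true  | false = z≤n
  ... | true  | true  = z≤n

-- Sums over Fin

sum-mono : ∀ {n} {f g : Fin n → ℕ} → (∀ i → f i ≤ g i) → sum f ≤ sum g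
sum-mono {zero}  f≤g = z≤n
sum-mono {suc n} f≤g = +-mono-≤ (f≤g zero) (sum-mono (f≤g ∘ suc))

sum-const : ∀ n c → sum {n} (λ _ → c) ≡ n * c
sum-const zero    c = refl
sum-const (suc n) c = cong (c +_) (sum-const n c)

term≤sum : ∀ {n} (f : Fin n → ℕ) i → f i ≤ sum f
term≤sum f zero    = m≤m+n _ _
term≤sum f (suc i) = ≤-trans (term≤sum (f ∘ suc) i) (m≤n+m _ _)

-- Some value is at least k - 1 by the pigeonhole principle; remove it and recurse.
injective⇒sum≥triangle : ∀ {k} (f : Fin k → ℕ) → Injective _≡_ _≡_ f → k * suc k ≤ 2 * sum (suc ∘ f)
injective⇒sum≥triangle {zero} f inj = z≤n
injective⇒sum≥triangle {suc k} f inj with Fin.any? (λ i → k ≤? f i)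
... | yes (i , k≤fi) = begin
  suc k * suc (suc k)                                 ≡⟨ expand k ⟩
  2 * suc k + k * suc k                               ≤⟨ +-mono-≤ (*-monoʳ-≤ 2 (s≤s k≤fi))
                                                           (injective⇒sum≥triangle (f ∘ punchIn i) (Fin.punchIn-injective i _ _ ∘ inj)) ⟩
  2 * suc (f i) + 2 * sum (suc ∘ f ∘ punchIn i)       ≡⟨ *-distribˡ-+ 2 (suc (f i)) _ ⟨
  2 * (suc (f i) + sum (suc ∘ f ∘ punchIn i))         ≡⟨ cong (2 *_) (∑.sum-remove {i = i} (suc ∘ f)) ⟨
  2 * sum (suc ∘ f)                                   ∎
  where
  expand : ∀ k → suc k * suc (suc k) ≡ 2 * suc k + k * suc k
  expand = solve-∀
... | no all< = contradiction (Fin.injective⇒≤ {f = λ i → fromℕ< (f<k i)}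
                  (λ eq → inj (Fin.fromℕ<-injective _ _ (f<k _) (f<k _) eq))) 1+n≰n
  where
  f<k : ∀ i → f i < k
  f<k i = ≰⇒> (λ k≤fi → all< (i , k≤fi))

-- Permutations

-- If `j` were missed, putting it in front of the values of `f` would inject `Fin (suc n)` into
-- `Fin n`.
injective⇒surjective : ∀ {n} (f : Fin n → Fin n) → Injective _≡_ _≡_ f → ∀ j → ∃ λ i → f i ≡ j
injective⇒surjective {n} f inj j with Fin.any? (λ i → f i Fin.≟ j)
... | yes hit = hit
... | no miss = contradiction (Fin.injective⇒≤ {f = g} g-injective) 1+n≰n
  where
  g : Fin (suc n) → Fin n
  g zero    = j
  g (suc i) = f i
  g-injective : Injective _≡_ _≡_ g
  g-injective {zero}  {zero}  _  = refl
  g-injective {zero}  {suc i} eq = contradiction (i , sym eq) miss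
  g-injective {suc i} {zero}  eq = contradiction (i , eq) miss
  g-injective {suc i} {suc j} eq = cong suc (inj eq)

injective⇒perm : ∀ {n} (f : Fin n → Fin n) → Injective _≡_ _≡_ f → Perm n
injective⇒perm f inj = permutation f (proj₁ ∘ surj) (proj₂ ∘ surj) (λ i → inj (proj₂ (surj (f i))))
  where surj = injective⇒surjective f inj

injective? : ∀ {n} (f : Fin n → Fin n) → Dec (∀ i j → f i ≡ f j → i ≡ j)
injective? f = Fin.all? (λ i → Fin.all? (λ j → (f i Fin.≟ f j) →-dec (i Fin.≟ j)))

toPerm : ∀ {n} → (Fin n → Fin n) → Perm n
toPerm f with injective? f
... | yes inj = injective⇒perm f (inj _ _)
... | no _    = Perm.id

toPerm-⟨$⟩ʳ : ∀ {n} (f : Fin n → Fin n) → Injective _≡_ _≡_ f → toPerm f ⟨$⟩ʳ_ ≗ f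
toPerm-⟨$⟩ʳ f inj i with injective? f
... | yes _   = refl
... | no ¬inj = contradiction (λ _ _ → inj) ¬inj

⟨$⟩ʳ-injective : ∀ {n} (π : Perm n) → Injective _≡_ _≡_ (π ⟨$⟩ʳ_)
⟨$⟩ʳ-injective π eq = trans (sym (inverseˡ π)) (trans (cong (π Perm.⟨$⟩ˡ_) eq) (inverseˡ π))

-- The index runs over codes of all functions; those that are not injective fall back to the
-- identity. The repetitions are harmless, as the number of experts enters only the additive
-- constant.
expert : ∀ {n} → Fin (n ^ n) → Perm n
expert x = toPerm (finToFun x)

expert-complete : ∀ {n} (π : Perm n) → ∃ λ x → ∀ e → expert x ⟨$⟩ʳ e ≡ π ⟨$⟩ʳ e
expert-complete π = funToFin (π ⟨$⟩ʳ_) , λ e →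
  trans (toPerm-⟨$⟩ʳ _ (λ {i} {j} eq → ⟨$⟩ʳ-injective π (trans (sym (code i)) (trans eq (code j)))) e) (code e)
  where
  code = Fin.finToFun-funToFin (π ⟨$⟩ʳ_)

-- Ranking by an injective key

module Ranking {n m : ℕ} (g : Fin n → Fin m) (inj : Injective _≡_ _≡_ g) where

  below : Fin n → Subset n
  below e = Vec.tabulate (λ e′ → does (g e′ Fin.<? g e))

  ∈below⁺ : ∀ {e e′} → g e′ Fin.< g e → e′ ∈ below e
  ∈below⁺ {e} {e′} lt = lookup⇒[]= e′ _ (trans (lookup∘tabulate _ e′) (dec-true (g e′ Fin.<? g e) lt))

  ∈below⁻ : ∀ {e e′} → e′ ∈ below e → g e′ Fin.< g e
  ∈below⁻ {e} {e′} e′∈ = <ᵇ⇒< _ _ (subst T (trans (sym ([]=⇒lookup e′∈)) (lookup∘tabulate _ e′)) _)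

  -- The inclusion is strict because `e` lies in `Q` but not below itself. With `Q` the full set
  -- this bounds ranks by n, with `Q` another `below` it makes them monotone, and in general it
  -- bounds positions.
  ∣below∣< : ∀ e Q → (∀ e′ → g e′ Fin.≤ g e → e′ ∈ Q) → ∣ below e ∣ < ∣ Q ∣
  ∣below∣< e Q ≤⇒∈ = p⊂q⇒∣p∣<∣q∣
    ((λ e′∈ → ≤⇒∈ _ (<⇒≤ (∈below⁻ e′∈))) , e , ≤⇒∈ e ≤-refl , λ e∈ → <-irrefl refl (∈below⁻ e∈))

  rank< : ∀ e → ∣ below e ∣ < n
  rank< e = subst (∣ below e ∣ <_) (∣⊤∣≡n n) (∣below∣< e ⊤ (λ _ _ → ∈⊤))

  rank : Fin n → Fin n
  rank e = fromℕ< (rank< e)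

  ∣below∣-mono : ∀ {e e′} → g e Fin.< g e′ → ∣ below e ∣ < ∣ below e′ ∣
  ∣below∣-mono {e} {e′} lt = ∣below∣< e (below e′) (λ _ le → ∈below⁺ (≤-<-trans le lt))

  rank-injective : Injective _≡_ _≡_ rank
  rank-injective {e} {e′} eq with Fin.<-cmp (g e) (g e′)
  ... | tri< lt _ _ = contradiction (Fin.fromℕ<-injective _ _ (rank< e) (rank< e′) eq) (<⇒≢ (∣below∣-mono lt))
  ... | tri≈ _ ge≡ _ = inj ge≡
  ... | tri> _ _ gt = contradiction (sym (Fin.fromℕ<-injective _ _ (rank< e) (rank< e′) eq)) (<⇒≢ (∣below∣-mono gt))

  -- Abstract, as otherwise conversion checking unfolds the permutation; likewise for `round` below.
  abstract
    rankPerm : Perm n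
    rankPerm = injective⇒perm rank rank-injective

    pos-rankPerm : ∀ e Q → (∀ e′ → g e′ Fin.≤ g e → e′ ∈ Q) → pos rankPerm e ≤ ∣ Q ∣
    pos-rankPerm e Q ≤⇒∈ = subst (_≤ ∣ Q ∣) (cong suc (sym (Fin.toℕ-fromℕ< (rank< e)))) (∣below∣< e Q ≤⇒∈)

-- Greedy rounding

requests : ∀ n r → List (Request n r)
requests zero    zero    = [ Vec.[] , refl ]
requests zero    (suc r) = []
requests (suc n) zero    = map (λ (S , eq) → outside Vec.∷ S , eq) (requests n zero)
requests (suc n) (suc r) = map (λ (S , eq) → outside Vec.∷ S , eq) (requests n (suc r))
                        ++ map (λ (S , eq) → inside Vec.∷ S , cong suc eq) (requests n r)

∈-requests : ∀ {n r} (S : Request n r) → S ∈ᴸ requests n r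
∈-requests {zero}  {zero}  (Vec.[] , refl) = here refl
∈-requests {suc n} {zero}  (outside Vec.∷ S , eq) = ∈-map⁺ _ (∈-requests (S , eq))
∈-requests {suc n} {suc r} (outside Vec.∷ S , eq) = ∈-++⁺ˡ (∈-map⁺ _ (∈-requests (S , eq)))
∈-requests {suc n} {suc r} (inside Vec.∷ S , refl) = ∈-++⁺ʳ (map _ (requests n (suc r))) (∈-map⁺ _ (∈-requests (S , refl)))

Meets : ∀ {n} → Subset n → Subset n → Set
Meets S P = ∃ λ e → e ∈ S × e ∈ P

meets? : ∀ {n} (S P : Subset n) → Dec (Meets S P)
meets? S P = Fin.any? (λ e → (e ∈? S) ×-dec (e ∈? P))

∣p∪q∣≤∣p∣+∣q∣ : ∀ {n} (p q : Subset n) → ∣ p ∪ q ∣ ≤ ∣ p ∣ + ∣ q ∣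
∣p∪q∣≤∣p∣+∣q∣ Vec.[]              Vec.[]              = z≤n
∣p∪q∣≤∣p∣+∣q∣ (inside  Vec.∷ p) (inside  Vec.∷ q) = s≤s (≤-trans (∣p∪q∣≤∣p∣+∣q∣ p q) (+-monoʳ-≤ ∣ p ∣ (n≤1+n _)))
∣p∪q∣≤∣p∣+∣q∣ (inside  Vec.∷ p) (outside Vec.∷ q) = s≤s (∣p∪q∣≤∣p∣+∣q∣ p q)
∣p∪q∣≤∣p∣+∣q∣ (outside Vec.∷ p) (inside  Vec.∷ q) = ≤-trans (s≤s (∣p∪q∣≤∣p∣+∣q∣ p q)) (≤-reflexive (sym (+-suc ∣ p ∣ _)))
∣p∪q∣≤∣p∣+∣q∣ (outside Vec.∷ p) (outside Vec.∷ q) = ∣p∪q∣≤∣p∣+∣q∣ p q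

module Greedy {n r : ℕ} where

  Disjoint : Request n r → Request n r → Set
  Disjoint S T = ¬ Meets (proj₁ S) (proj₁ T)

  -- `P` collects the union of the sets kept so far, so meeting `P` means meeting one of them.
  greedy : Subset n → List (Request n r) → List (Request n r)
  greedy P []       = []
  greedy P (S ∷ Ss) with meets? (proj₁ S) P
  ... | yes _ = greedy P Ss
  ... | no _  = S ∷ greedy (proj₁ S ∪ P) Ss

  greedy-All : ∀ {Q : Request n r → Set} P {Ss} → All Q Ss → All Q (greedy P Ss)
  greedy-All P [] = []
  greedy-All P {S ∷ Ss} (q ∷ qs) with meets? (proj₁ S) P
  ... | yes _ = greedy-All P qs
  ... | no _  = q ∷ greedy-All (proj₁ S ∪ P) qs

  -- The output is a subsequence of the input. With the order by cost as `R`, the kept sets stay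
  -- sorted.
  greedy-AllPairs : ∀ {R : Request n r → Request n r → Set} P {Ss} → AllPairs R Ss → AllPairs R (greedy P Ss)
  greedy-AllPairs P [] = []
  greedy-AllPairs P {S ∷ Ss} (q ∷ qs) with meets? (proj₁ S) P
  ... | yes _ = greedy-AllPairs P qs
  ... | no _  = greedy-All _ q ∷ greedy-AllPairs (proj₁ S ∪ P) qs

  greedy-avoids : ∀ P Ss → All (λ S → ¬ Meets (proj₁ S) P) (greedy P Ss)
  greedy-avoids P []       = []
  greedy-avoids P (S ∷ Ss) with meets? (proj₁ S) P
  ... | yes _    = greedy-avoids P Ss
  ... | no ¬meet = ¬meet ∷ All.map (λ avoids (e , e∈ , e∈P) → avoids (e , e∈ , x∈p∪q⁺ (inj₂ e∈P)))
                                   (greedy-avoids (proj₁ S ∪ P) Ss)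

  greedy-disjoint : ∀ P Ss → AllPairs Disjoint (greedy P Ss)
  greedy-disjoint P []       = []
  greedy-disjoint P (S ∷ Ss) with meets? (proj₁ S) P
  ... | yes _ = greedy-disjoint P Ss
  ... | no _  = All.map (λ avoids (e , e∈S , e∈T) → avoids (e , e∈T , x∈p∪q⁺ (inj₁ e∈S)))
                        (greedy-avoids (proj₁ S ∪ P) Ss)
              ∷ greedy-disjoint (proj₁ S ∪ P) Ss

  -- A set is dropped only for meeting the initial `P` or an earlier kept set, and the latter is ≼
  -- it by sortedness. A kept set is its own witness, being nonempty. Starting from ⊥ excludes the
  -- first alternative.
  greedy-covers : (_≼_ : Request n r → Request n r → Set) (refl≼ : ∀ {S} → S ≼ S) →
    (∀ S → Nonempty (proj₁ S)) → ∀ P {Ss} → AllPairs _≼_ Ss → ∀ {S} → S ∈ᴸ Ss →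
    Meets (proj₁ S) P ⊎ Any (λ T → Meets (proj₁ S) (proj₁ T) × T ≼ S) (greedy P Ss)
  greedy-covers _≼_ refl≼ ne P {T ∷ Ss} (T≼ ∷ sorted) S∈ with meets? (proj₁ T) P | S∈
  ... | yes meet | here refl = inj₁ meet
  ... | yes meet | there S∈′ = greedy-covers _≼_ refl≼ ne P sorted S∈′
  ... | no _ | here refl with e , e∈ ← ne T = inj₂ (here ((e , e∈ , e∈) , refl≼))
  ... | no _ | there S∈′ with greedy-covers _≼_ refl≼ ne (proj₁ T ∪ P) sorted S∈′
  ...   | inj₂ hit = inj₂ (there hit)
  ...   | inj₁ (e , e∈S , e∈T∪P) with x∈p∪q⁻ (proj₁ T) P e∈T∪P
  ...     | inj₁ e∈T = inj₂ (here ((e , e∈S , e∈T) , All.lookup T≼ S∈′))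
  ...     | inj₂ e∈P = inj₁ (e , e∈S , e∈P)

  AllPairs-lookup-< : ∀ {R : Request n r → Request n r → Set} {Ss} → AllPairs R Ss →
    ∀ {i j} → i Fin.< j → R (lookup Ss i) (lookup Ss j)
  AllPairs-lookup-< (q ∷ qs) {zero}  {suc j} _         = All.lookup q (∈-lookup j)
  AllPairs-lookup-< (q ∷ qs) {suc i} {suc j} (s≤s i<j) = AllPairs-lookup-< qs i<j


  -- An element outside all sets gets the extra value `length Ss` and so is ranked after the covered
  -- ones.
  block : (Ss : List (Request n r)) → Fin n → Fin (suc (length Ss))
  block []       e = zero
  block (S ∷ Ss) e with e ∈? proj₁ S
  ... | yes _ = zero
  ... | no _  = suc (block Ss e)

  block≤ : ∀ Ss i {e} → e ∈ proj₁ (lookup Ss i) → toℕ (block Ss e) ≤ toℕ i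
  block≤ (S ∷ Ss) i {e} e∈ with e ∈? proj₁ S
  block≤ (S ∷ Ss) i       e∈ | yes _  = z≤n
  block≤ (S ∷ Ss) zero    e∈ | no e∉S = contradiction e∈ e∉S
  block≤ (S ∷ Ss) (suc i) e∈ | no _   = s≤s (block≤ Ss i e∈)

  -- `Q` is the union of the first i + 1 sets, which have r elements each.
  firstBlocks : ∀ Ss (i : Fin (length Ss)) →
    ∃ λ Q → (∀ e → toℕ (block Ss e) ≤ toℕ i → e ∈ Q) × ∣ Q ∣ ≤ suc (toℕ i) * r
  firstBlocks (S ∷ Ss) zero = proj₁ S , covers , ≤-reflexive (trans (proj₂ S) (sym (*-identityˡ r)))
    where
    covers : ∀ e → toℕ (block (S ∷ Ss) e) ≤ 0 → e ∈ proj₁ S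
    covers e b≤ with e ∈? proj₁ S
    covers e b≤ | yes e∈ = e∈
    covers e () | no _
  firstBlocks (S ∷ Ss) (suc i) with Q , Q-covers , ∣Q∣≤ ← firstBlocks Ss i =
    proj₁ S ∪ Q , covers , ≤-trans (∣p∪q∣≤∣p∣+∣q∣ (proj₁ S) Q) (+-mono-≤ (≤-reflexive (proj₂ S)) ∣Q∣≤)
    where
    covers : ∀ e → toℕ (block (S ∷ Ss) e) ≤ suc (toℕ i) → e ∈ proj₁ S ∪ Q
    covers e b≤ with e ∈? proj₁ S
    covers e b≤       | yes e∈ = x∈p∪q⁺ (inj₁ e∈)
    covers e (s≤s b≤) | no _   = x∈p∪q⁺ (inj₂ (Q-covers e b≤))

  -- The key is lexicographic: the block decides, and the element itself breaks ties, which makes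
  -- the key injective.
  module _ (Ss : List (Request n r)) where
    open Ranking (λ e → combine (block Ss e) e)
      (λ {e} {e′} → Fin.combine-injectiveʳ (block Ss e) e (block Ss e′) e′) public
      using () renaming (rankPerm to blockOrder; pos-rankPerm to pos-blockOrder)

  -- Whatever is ranked no later than the common element `e` lies in the first i + 1 sets, so the
  -- position of `e` is at most the size of their union.
  access-blockOrder : (Ss : List (Request n r)) (i : Fin (length Ss)) (S : Request n r) →
    Meets (proj₁ S) (proj₁ (lookup Ss i)) →
    access (blockOrder Ss) (proj₁ S) ≤ suc (toℕ i) * r
  access-blockOrder Ss i S (e , e∈S , e∈Sᵢ) with Q , Q-covers , ∣Q∣≤ ← firstBlocks Ss i = begin
    access (blockOrder Ss) (proj₁ S) ≤⟨ access≤pos (blockOrder Ss) e∈S ⟩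
    pos (blockOrder Ss) e            ≤⟨ pos-blockOrder Ss e Q (λ e′ key≤ → Q-covers e′
                                          (≤-trans (block-mono key≤) (block≤ Ss i e∈Sᵢ))) ⟩
    ∣ Q ∣                            ≤⟨ ∣Q∣≤ ⟩
    suc (toℕ i) * r                  ∎
    where
    block-mono : ∀ {e e′} → combine (block Ss e′) e′ Fin.≤ combine (block Ss e) e →
      toℕ (block Ss e′) ≤ toℕ (block Ss e)
    block-mono {e} {e′} key≤ = ≮⇒≥ (λ lt → <⇒≱ (Fin.combine-monoˡ-< e e′ lt) key≤)

∣p∣>0⇒Nonempty : ∀ {n} (p : Subset n) → 0 < ∣ p ∣ → Nonempty p
∣p∣>0⇒Nonempty {n} p ∣p∣>0 with nonempty? p
... | yes ne = ne
... | no ¬ne = contradiction (subst (λ q → 0 < ∣ q ∣) (Empty-unique ¬ne) ∣p∣>0) (λ lt → <-irrefl (sym (∣⊥∣≡0 n)) lt)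

-- Disjoint sets attain their minima at distinct elements, so the access costs are k distinct
-- positive integers.
disjoint-access-triangle : ∀ {n k} (π : Perm n) (S : Fin k → Subset n) → (∀ i → Nonempty (S i)) →
  (∀ {i j} → i ≢ j → ¬ Meets (S i) (S j)) → k * suc k ≤ 2 * sum (λ i → access π (S i))
disjoint-access-triangle {n} {k} π S ne disjoint = begin
  k * suc k                       ≤⟨ injective⇒sum≥triangle (λ i → toℕ (π ⟨$⟩ʳ e i)) injective ⟩
  2 * sum (λ i → pos π (e i))     ≡⟨ cong (2 *_) (∑.sum-cong-≗ (λ i → sym (proj₂ (proj₂ (attained i))))) ⟩
  2 * sum (λ i → access π (S i))  ∎
  where
  attained : ∀ i → ∃ λ e → e ∈ S i × access π (S i) ≡ pos π e
  attained i = access-attained π (ne i)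
  e : Fin k → Fin n
  e i = proj₁ (attained i)
  injective : Injective _≡_ _≡_ (λ i → toℕ (π ⟨$⟩ʳ e i))
  injective {i} {j} eq with i Fin.≟ j
  ... | yes i≡j = i≡j
  ... | no i≢j  = contradiction
    (e i , proj₁ (proj₂ (attained i)) , subst (_∈ S j) (sym (⟨$⟩ʳ-injective π (Fin.toℕ-injective eq)))
      (proj₁ (proj₂ (attained j))))
    (disjoint i≢j)

-- Rounding a weighting of the permutations

module Rounding {n r N : ℕ} (1≤r : 1 ≤ r) (π : Fin N → Perm n) where

  nonempty : (S : Request n r) → Nonempty (proj₁ S)
  nonempty (S , ∣S∣≡r) = ∣p∣>0⇒Nonempty S (subst (0 <_) (sym ∣S∣≡r) 1≤r)

  -- The weighted average of the access cost times the total weight, which avoids division.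
  cost : (Fin N → ℕ) → Request n r → ℕ
  cost w S = sum (λ x → w x * access (π x) (proj₁ S))

  -- The triangle bound is summed over the permutations with weights `w`; after exchanging the sums,
  -- each of the k sets contributes at most `c`, and a factor k cancels.
  disjoint-cost : ∀ w {k} .{{_ : NonZero k}} (B : Fin k → Request n r) →
    (∀ {i j} → i ≢ j → Greedy.Disjoint (B i) (B j)) → ∀ c → (∀ j → cost w (B j) ≤ c) →
    sum w * suc k ≤ 2 * c
  disjoint-cost w {k} B disjoint c cost≤c = *-cancelˡ-≤ k (begin
    k * (sum w * suc k)                       ≡⟨ swap k (sum w) (suc k) ⟩
    sum w * (k * suc k)                       ≡⟨ ∑.*-distribʳ-sum (k * suc k) w ⟩
    sum (λ x → w x * (k * suc k))             ≤⟨ sum-mono (λ x → *-monoʳ-≤ (w x) (triangle x)) ⟩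
    sum (λ x → w x * (2 * sum (a x)))         ≡⟨ ∑.sum-cong-≗ (λ x → swap (w x) 2 (sum (a x))) ⟩
    sum (λ x → 2 * (w x * sum (a x)))         ≡⟨ ∑.*-distribˡ-sum 2 (λ x → w x * sum (a x)) ⟨
    2 * sum (λ x → w x * sum (a x))
      ≡⟨ cong (2 *_) (∑.sum-cong-≗ (λ x → ∑.*-distribˡ-sum (w x) (a x))) ⟩
    2 * sum (λ x → sum (λ j → w x * a x j))   ≡⟨ cong (2 *_) (∑.∑-comm (λ x j → w x * a x j)) ⟩
    2 * sum (λ j → cost w (B j))              ≤⟨ *-monoʳ-≤ 2 (sum-mono cost≤c) ⟩
    2 * sum {k} (λ _ → c)                     ≡⟨ cong (2 *_) (sum-const k c) ⟩
    2 * (k * c)                               ≡⟨ swap 2 k c ⟩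
    k * (2 * c)                               ∎)
    where
    a : Fin N → Fin k → ℕ
    a x j = access (π x) (proj₁ (B j))
    triangle : ∀ x → k * suc k ≤ 2 * sum (a x)
    triangle x = disjoint-access-triangle (π x) (proj₁ ∘ B) (nonempty ∘ B) disjoint
    swap : ∀ k w m → k * (w * m) ≡ w * (k * m)
    swap = solve-∀

  module _ (w : Fin N → ℕ) where

    open Greedy {n} {r}

    module Sort = Data.List.Sort (On.decTotalOrder ≤-decTotalOrder (cost w))

    sorted : AllPairs (_≤_ on cost w) (Sort.sort (requests n r))
    sorted = Linked⇒AllPairs ≤-trans (Sort.sort-↗ (requests n r))

    blocks : List (Request n r)
    blocks = greedy ⊥ (Sort.sort (requests n r))

    abstract
      round : Perm n
      round = blockOrder blocks

    blocks-disjoint : ∀ {i j} → i ≢ j → Disjoint (lookup blocks i) (lookup blocks j)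
    blocks-disjoint {i} {j} i≢j with Fin.<-cmp i j
    ... | tri< i<j _ _ = AllPairs-lookup-< (greedy-disjoint ⊥ (Sort.sort (requests n r))) i<j
    ... | tri≈ _ i≡j _ = contradiction i≡j i≢j
    ... | tri> _ _ j<i = λ (e , e∈i , e∈j) →
      AllPairs-lookup-< (greedy-disjoint ⊥ (Sort.sort (requests n r))) j<i (e , e∈j , e∈i)

    cost-mono : ∀ {i j} → i Fin.≤ j → cost w (lookup blocks i) ≤ cost w (lookup blocks j)
    cost-mono {i} {j} i≤j with Fin.<-cmp i j
    ... | tri< i<j _ _  = AllPairs-lookup-< (greedy-AllPairs ⊥ sorted) i<j
    ... | tri≈ _ refl _ = ≤-refl
    ... | tri> _ _ j<i  = contradiction i≤j (<⇒≱ j<i)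

    covered : ∀ S → Any (λ T → Meets (proj₁ S) (proj₁ T) × cost w T ≤ cost w S) blocks
    covered S with greedy-covers (_≤_ on cost w) ≤-refl nonempty ⊥ sorted
                     (∈-resp-↭ (↭-sym (Sort.sort-↭ (requests n r))) (∈-requests S))
    ... | inj₁ (e , _ , e∈⊥) = contradiction e∈⊥ ∉⊥
    ... | inj₂ hit           = hit

    -- Blocks 0 to i are i + 1 disjoint sets, and by sortedness none costs more than block i.
    prefix-cost : (S : Request n r) (i : Fin (length blocks)) → cost w (lookup blocks i) ≤ cost w S →
      sum w * suc (suc (toℕ i)) ≤ 2 * cost w S
    prefix-cost S i cost≤ = disjoint-cost w (λ j → lookup blocks (inject≤ j (Fin.toℕ<n i)))
      (λ i≢j → blocks-disjoint (λ eq → i≢j (Fin.inject≤-injective _ _ _ _ eq)))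
      (cost w S) (λ j → ≤-trans (cost-mono (index≤i j)) cost≤)
      where
      index≤i : ∀ j → inject≤ j (Fin.toℕ<n i) Fin.≤ i
      index≤i j = ≤-trans (≤-reflexive (Fin.toℕ-inject≤ j _)) (s≤s⁻¹ (Fin.toℕ<n j))

    abstract
      -- `S` meets a block i that costs no more than `S`. Its access cost is then at most (i + 1) r,
      -- while `prefix-cost` bounds i + 2 times the total weight by twice the cost of `S`.
      round-cost : ∀ S → sum w * access round (proj₁ S) ≤ 2 * r * cost w S
      round-cost S with meets , cost≤ ← lookup-index (covered S) = begin
        sum w * access round (proj₁ S)  ≤⟨ *-monoʳ-≤ (sum w) (access-blockOrder blocks i S meets) ⟩
        sum w * (suc (toℕ i) * r)       ≤⟨ *-monoʳ-≤ (sum w) (*-monoˡ-≤ r (n≤1+n (suc (toℕ i)))) ⟩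
        sum w * (suc (suc (toℕ i)) * r) ≡⟨ *-assoc (sum w) _ r ⟨
        sum w * suc (suc (toℕ i)) * r   ≤⟨ *-monoˡ-≤ r (prefix-cost S i cost≤) ⟩
        2 * cost w S * r                ≡⟨ swap (cost w S) r ⟩
        2 * r * cost w S                ∎
        where
        i : Fin (length blocks)
        i = Any.index (covered S)
        swap : ∀ c r → 2 * c * r ≡ 2 * r * c
        swap = solve-∀

-- Multiplicative weights

-- 1 - a/K ≤ (1 + 1/K)^(-a)
∸-*-^-upper : ∀ K a → (K ∸ a) * suc K ^ a ≤ K ^ suc a
∸-*-^-upper K zero    = ≤-refl
∸-*-^-upper K (suc a) = begin
  (K ∸ suc a) * (suc K * suc K ^ a) ≡⟨ *-assoc (K ∸ suc a) (suc K) _ ⟨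
  (K ∸ suc a) * suc K * suc K ^ a
    ≤⟨ *-monoˡ-≤ (suc K ^ a) (subst (λ d → d * suc K ≤ (K ∸ a) * K) (pred[m∸n]≡m∸[1+n] K a) (pred-* (K ∸ a) (m∸n≤m K a))) ⟩
  (K ∸ a) * K * suc K ^ a           ≡⟨ rearrange (K ∸ a) K (suc K ^ a) ⟩
  K * ((K ∸ a) * suc K ^ a)         ≤⟨ *-monoʳ-≤ K (∸-*-^-upper K a) ⟩
  K * K ^ suc a                     ∎
  where
  rearrange : ∀ d k p → d * k * p ≡ k * (d * p)
  rearrange = solve-∀
  pred-* : ∀ d → d ≤ K → pred d * suc K ≤ d * K
  pred-* zero    _   = z≤n
  pred-* (suc d) d<K = begin
    d * suc K ≡⟨ *-suc d K ⟩
    d + d * K ≤⟨ +-monoˡ-≤ (d * K) (<⇒≤ d<K) ⟩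
    K + d * K ∎

-- (1 + 1/K)^(-2u) ≤ 1 - u/K
∸-*-^-lower : ∀ K u → 2 * u ≤ K → K ^ suc (2 * u) ≤ suc K ^ (2 * u) * (K ∸ u)
∸-*-^-lower K zero    _    = ≤-reflexive (*-comm K 1)
∸-*-^-lower K (suc u) 2u≤K with d , K≡ ← m≤n⇒∃[o]m+o≡n 2u≤K = begin
  K ^ suc (2 * suc u)                               ≡⟨ cong (λ m → K ^ suc m) (*-suc 2 u) ⟩
  K * (K * K ^ suc (2 * u))
    ≤⟨ *-monoʳ-≤ K (*-monoʳ-≤ K (∸-*-^-lower K u (≤-trans (*-monoʳ-≤ 2 (n≤1+n u)) 2u≤K))) ⟩
  K * (K * (P * (K ∸ u)))                           ≡⟨ left K P (K ∸ u) ⟩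
  P * (K * K * (K ∸ u))                             ≤⟨ *-monoʳ-≤ P core ⟩
  P * (suc K * suc K * (K ∸ suc u))                 ≡⟨ right (suc K) P (K ∸ suc u) ⟩
  suc K * (suc K * P) * (K ∸ suc u)                 ≡⟨ cong (λ m → suc K ^ m * (K ∸ suc u)) (*-suc 2 u) ⟨
  suc K ^ (2 * suc u) * (K ∸ suc u)                 ∎
  where
  P = suc K ^ (2 * u)
  left : ∀ k p d → k * (k * (p * d)) ≡ p * (k * k * d)
  left = solve-∀
  right : ∀ k p d → p * (k * k * d) ≡ k * (k * p) * d
  right = solve-∀
  K≡u+ : K ≡ suc u + (suc u + d)
  K≡u+ = trans (sym K≡) (regroup u d)
    where
    regroup : ∀ u d → 2 * suc u + d ≡ suc u + (suc u + d)
    regroup = solve-∀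
  K∸su : K ∸ suc u ≡ suc u + d
  K∸su = trans (cong (_∸ suc u) K≡u+) (m+n∸m≡n (suc u) _)
  K∸u : K ∸ u ≡ suc (suc u + d)
  K∸u = trans (cong (_∸ u) (trans K≡u+ (sym (+-suc u _)))) (m+n∸m≡n u _)
  -- With x = u + 1 + d this is K² (x + 1) ≤ (K + 1)² x, that is, K² ≤ (2K + 1) x, which follows
  -- from K ≤ 2x.
  core : K * K * (K ∸ u) ≤ suc K * suc K * (K ∸ suc u)
  core = begin
    K * K * (K ∸ u)                   ≡⟨ cong (K * K *_) K∸u ⟩
    K * K * suc (suc u + d)           ≡⟨ *-suc (K * K) (suc u + d) ⟩
    K * K + K * K * (suc u + d)       ≤⟨ +-monoˡ-≤ _ (begin
      K * K                           ≡⟨ cong (K *_) K≡u+ ⟩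
      K * (suc u + (suc u + d))       ≤⟨ *-monoʳ-≤ K (+-monoˡ-≤ (suc u + d) (m≤m+n (suc u) d)) ⟩
      K * (suc u + d + (suc u + d))   ≡⟨ double K (suc u + d) ⟩
      2 * K * (suc u + d)             ≤⟨ *-monoˡ-≤ (suc u + d) (n≤1+n (2 * K)) ⟩
      suc (2 * K) * (suc u + d)       ∎) ⟩
    suc (2 * K) * (suc u + d) + K * K * (suc u + d) ≡⟨ square K (suc u + d) ⟩
    suc K * suc K * (suc u + d)       ≡⟨ cong (suc K * suc K *_) K∸su ⟨
    suc K * suc K * (K ∸ suc u)       ∎
    where
    double : ∀ k x → k * (x + x) ≡ 2 * k * x
    double = solve-∀
    square : ∀ k x → suc (2 * k) * x + k * k * x ≡ suc k * suc k * x
    square = solve-∀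

-- This is 1 + D/K ≤ (1 + 1/K)^D with denominators cleared.
bernoulli : ∀ K D → K ^ D * (K + D) ≤ K * suc K ^ D
bernoulli K zero    = ≤-reflexive (base K)
  where
  base : ∀ K → 1 * (K + 0) ≡ K * 1
  base = solve-∀
bernoulli K (suc D) = begin
  K * K ^ D * (K + suc D)       ≡⟨ expand K D (K ^ D) ⟩
  K ^ D * (K * (K + D) + K)     ≤⟨ *-monoʳ-≤ (K ^ D) (+-monoʳ-≤ (K * (K + D)) (m≤m+n K D)) ⟩
  K ^ D * (K * (K + D) + (K + D)) ≡⟨ factor K D (K ^ D) ⟩
  suc K * (K ^ D * (K + D))     ≤⟨ *-monoʳ-≤ (suc K) (bernoulli K D) ⟩
  suc K * (K * suc K ^ D)       ≡⟨ swap K (suc K ^ D) ⟩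
  K * (suc K * suc K ^ D)       ∎
  where
  expand : ∀ K D p → K * p * (K + suc D) ≡ p * (K * (K + D) + K)
  expand = solve-∀
  factor : ∀ K D p → p * (K * (K + D) + (K + D)) ≡ suc K * (p * (K + D))
  factor = solve-∀
  swap : ∀ K p → suc K * (K * p) ≡ K * (suc K * p)
  swap = solve-∀

-- The hypothesis is A·log(1 + 1/K) ≤ C·log(1 + 1/K) + log N without logarithms.
exponent-bound : ∀ K N A C → .{{NonZero K}} →
  suc K ^ A * K ^ C ≤ N * K ^ A * suc K ^ C → A ≤ C + N * K
exponent-bound K N A C hyp with ≤-total A C
... | inj₁ A≤C = ≤-trans A≤C (m≤m+n C _)
-- For A = C + D the hypothesis becomes (1 + 1/K)^D ≤ N, and Bernoulli's inequality gives 1 + D/K ≤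
-- N. Having N in place of log N affects only the additive constant.
... | inj₂ C≤A with D , refl ← m≤n⇒∃[o]m+o≡n C≤A = +-monoʳ-≤ C (≤-trans (m≤n+m D K) K+D≤NK)
  where
  cancelled : suc K ^ D ≤ N * K ^ D
  cancelled = *-cancelʳ-≤ _ _ (suc K ^ C * K ^ C) {{m*n≢0 _ _ {{m^n≢0 (suc K) C}} {{m^n≢0 K C}}}} (begin
    suc K ^ D * (suc K ^ C * K ^ C)   ≡⟨ left (suc K ^ D) (suc K ^ C) (K ^ C) ⟩
    suc K ^ C * suc K ^ D * K ^ C     ≡⟨ cong (_* K ^ C) (^-distribˡ-+-* (suc K) C D) ⟨
    suc K ^ (C + D) * K ^ C           ≤⟨ hyp ⟩
    N * K ^ (C + D) * suc K ^ C       ≡⟨ cong (λ p → N * p * suc K ^ C) (^-distribˡ-+-* K C D) ⟩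
    N * (K ^ C * K ^ D) * suc K ^ C   ≡⟨ right N (K ^ C) (K ^ D) (suc K ^ C) ⟩
    N * K ^ D * (suc K ^ C * K ^ C)   ∎)
    where
    left : ∀ x y z → x * (y * z) ≡ y * x * z
    left = solve-∀
    right : ∀ n x y z → n * (x * y) * z ≡ n * y * (z * x)
    right = solve-∀
  K+D≤NK : K + D ≤ N * K
  K+D≤NK = *-cancelˡ-≤ (K ^ D) {{m^n≢0 K D}} (begin
    K ^ D * (K + D)   ≤⟨ bernoulli K D ⟩
    K * suc K ^ D     ≤⟨ *-monoʳ-≤ K cancelled ⟩
    K * (N * K ^ D)   ≡⟨ swap K N (K ^ D) ⟩
    K ^ D * (N * K)   ∎)
    where
    swap : ∀ k n p → k * (n * p) ≡ p * (n * k)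
    swap = solve-∀

-- The new total is K Σw - Σwu, and Σwu = c Σwv is at least b Σw. The bound u ≤ K makes the
-- truncated subtraction exact. Here b will be the access cost that the algorithm paid in a block.
reweight-sum : ∀ {N} K c (w u v : Fin N → ℕ) b → (∀ x → u x ≡ c * v x) → (∀ x → u x ≤ K) →
  sum w * b ≤ c * sum (λ x → w x * v x) → sum (λ x → w x * (K ∸ u x)) ≤ (K ∸ b) * sum w
reweight-sum K c w u v b u≡cv u≤K wb≤ = begin
  sum (λ x → w x * (K ∸ u x))   ≤⟨ m+n≤o⇒m≤o∸n _ total ⟩
  K * sum w ∸ b * sum w         ≡⟨ *-distribʳ-∸ (sum w) K b ⟨
  (K ∸ b) * sum w               ∎
  where
  pointwise : ∀ x → w x * (K ∸ u x) + c * (w x * v x) ≡ K * w x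
  pointwise x = begin-equality
    w x * (K ∸ u x) + c * (w x * v x)   ≡⟨ cong (w x * (K ∸ u x) +_) (swap c (w x) (v x)) ⟩
    w x * (K ∸ u x) + w x * (c * v x)   ≡⟨ cong (λ m → w x * (K ∸ u x) + w x * m) (u≡cv x) ⟨
    w x * (K ∸ u x) + w x * u x         ≡⟨ *-distribˡ-+ (w x) (K ∸ u x) (u x) ⟨
    w x * (K ∸ u x + u x)               ≡⟨ cong (w x *_) (m∸n+n≡m (u≤K x)) ⟩
    w x * K                             ≡⟨ *-comm (w x) K ⟩
    K * w x                             ∎
    where
    swap : ∀ c w v → c * (w * v) ≡ w * (c * v)
    swap = solve-∀
  total : sum (λ x → w x * (K ∸ u x)) + b * sum w ≤ K * sum w
  total = begin
    sum (λ x → w x * (K ∸ u x)) + b * sum w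
      ≡⟨ cong (sum (λ x → w x * (K ∸ u x)) +_) (*-comm b (sum w)) ⟩
    sum (λ x → w x * (K ∸ u x)) + sum w * b                         ≤⟨ +-monoʳ-≤ _ wb≤ ⟩
    sum (λ x → w x * (K ∸ u x)) + c * sum (λ x → w x * v x)
      ≡⟨ cong (sum (λ x → w x * (K ∸ u x)) +_) (∑.*-distribˡ-sum c (λ x → w x * v x)) ⟩
    sum (λ x → w x * (K ∸ u x)) + sum (λ x → c * (w x * v x))
      ≡⟨ ∑.∑-distrib-+ (λ x → w x * (K ∸ u x)) (λ x → c * (w x * v x)) ⟨
    sum (λ x → w x * (K ∸ u x) + c * (w x * v x))                   ≡⟨ ∑.sum-cong-≗ pointwise ⟩
    sum (λ x → K * w x)                                             ≡⟨ ∑.*-distribˡ-sum K w ⟨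
    K * sum w                                                       ∎

-- Up to a common factor K, the total shrinks at least by (1 + 1/K)^(-b) and the weight of the
-- expert at most by (1 + 1/K)^(-2u). The K multiplied in front completes the power in `∸-*-^-lower`
-- and returns from the power in `∸-*-^-upper`.
potential-step : ∀ K .{{_ : NonZero K}} N {W W′ wᵧ} A C b u → 2 * u ≤ K → W′ ≤ (K ∸ b) * W →
  W * suc K ^ A * K ^ C ≤ N * K ^ A * suc K ^ C * wᵧ →
  W′ * suc K ^ (A + b) * K ^ (C + 2 * u) ≤ N * K ^ (A + b) * suc K ^ (C + 2 * u) * (wᵧ * (K ∸ u))
potential-step K N {W} {W′} {wᵧ} A C b u 2u≤K W′≤ pot = *-cancelˡ-≤ K (begin
  K * (W′ * suc K ^ (A + b) * K ^ (C + 2 * u))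
    ≤⟨ *-monoʳ-≤ K (*-monoˡ-≤ (K ^ (C + 2 * u)) (*-monoˡ-≤ (suc K ^ (A + b)) W′≤)) ⟩
  K * ((K ∸ b) * W * suc K ^ (A + b) * K ^ (C + 2 * u))
    ≡⟨ cong₂ (λ p q → K * ((K ∸ b) * W * p * q)) (^-distribˡ-+-* (suc K) A b) (^-distribˡ-+-* K C (2 * u)) ⟩
  K * ((K ∸ b) * W * (suc K ^ A * suc K ^ b) * (K ^ C * K ^ (2 * u)))
    ≡⟨ left K (K ∸ b) W (suc K ^ A) (suc K ^ b) (K ^ C) (K ^ (2 * u)) ⟩
  (K ∸ b) * suc K ^ b * (W * suc K ^ A * K ^ C) * (K * K ^ (2 * u))
    ≤⟨ *-mono-≤ (*-mono-≤ (∸-*-^-upper K b) pot) (∸-*-^-lower K u 2u≤K) ⟩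
  K * K ^ b * (N * K ^ A * suc K ^ C * wᵧ) * (suc K ^ (2 * u) * (K ∸ u))
    ≡⟨ right K (K ^ b) N (K ^ A) (suc K ^ C) wᵧ (suc K ^ (2 * u)) (K ∸ u) ⟩
  K * (N * (K ^ A * K ^ b) * (suc K ^ C * suc K ^ (2 * u)) * (wᵧ * (K ∸ u)))
    ≡⟨ cong₂ (λ p q → K * (N * p * q * (wᵧ * (K ∸ u)))) (^-distribˡ-+-* K A b) (^-distribˡ-+-* (suc K) C (2 * u)) ⟨
  K * (N * K ^ (A + b) * suc K ^ (C + 2 * u) * (wᵧ * (K ∸ u))) ∎)
  where
  left : ∀ k d w a b c u → k * (d * w * (a * b) * (c * u)) ≡ d * b * (w * a * c) * (k * u)
  left = solve-∀
  right : ∀ k b n a c y u d → k * b * (n * a * c * y) * (u * d) ≡ k * (n * (a * b) * (c * u) * (y * d))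
  right = solve-∀

staticCost-cong : ∀ {n r} (π σ : Perm n) → (∀ (S : Request n r) → access π (proj₁ S) ≤ access σ (proj₁ S)) →
  ∀ reqs → staticCost {n} {r} π reqs ≤ staticCost σ reqs
staticCost-cong π σ π≤σ []         = z≤n
staticCost-cong π σ π≤σ (S ∷ reqs) = +-mono-≤ (π≤σ S) (staticCost-cong π σ π≤σ reqs)

-- The online algorithm

module MultiplicativeWeights (n r : ℕ) (1≤n : 1 ≤ n) (1≤r : 1 ≤ r) where

  N : ℕ
  N = n ^ n

  open Rounding {n} {r} {N} 1≤r expert

  -- `B` bounds the access cost of a block: n² + 1 requests of cost at most n. A scaled loss u = 2 r
  -- v is thus at most `half`, so that 2u ≤ K as `∸-*-^-lower` demands, and the factors K - u stay
  -- positive.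
  B half K : ℕ
  B = n * suc (n * n)
  half = 2 * r * B
  K = 2 * half

  0<half : 0 < half
  0<half = *-mono-≤ (*-mono-≤ (s≤s (z≤n {1})) 1≤r) (*-mono-≤ 1≤n (s≤s (z≤n {n * n})))

  instance
    K≢0 : NonZero K
    K≢0 = >-nonZero (≤-trans 0<half (m≤m+n half _))

  -- `left` counts the requests that the block takes before its last one. The weights are fixed
  -- within a block, while `loss` accumulates the experts' access costs in it.
  record State : Set where
    constructor state
    field
      current     : Perm n
      weight loss : Fin N → ℕ
      left        : ℕ

  open State

  restart : (Fin N → ℕ) → State
  restart w = state (round w) w (λ _ → 0) (n * n)

  charge : (Fin N → ℕ) → Request n r → Fin N → ℕ
  charge v S x = v x + access (expert x) (proj₁ S)

  -- The factor 1 - 2rv/K times K; scaling all weights alike does not change averages.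
  reweight : (Fin N → ℕ) → (Fin N → ℕ) → Fin N → ℕ
  reweight w v x = w x * (K ∸ 2 * r * v x)

  next : State → Request n r → State
  next (state ρ w v zero)    S = restart (reweight w (charge v S))
  next (state ρ w v (suc j)) S = state ρ w (charge v S) j

  init : State
  init = restart (λ _ → 1)

  -- The first request only serves to replace π₀, which no rounding guarantee covers.
  alg : OnlineAlg n r
  alg π₀ []       = π₀
  alg π₀ (_ ∷ Ss) = current (foldl next init Ss)

  -- Analysis against a fixed expert

  module _ (y : Fin N) where

    -- In logarithms, with λ = log(1 + 1/K): log (Σ w) + A λ ≤ log N + 4 r L λ + log wᵧ, where A is the
    -- access cost paid in the completed blocks and L the access cost of expert y there.
    Potential : (Fin N → ℕ) → ℕ → ℕ → Set
    Potential w A L = sum w * suc K ^ A * K ^ (2 * (2 * r * L)) ≤ N * K ^ A * suc K ^ (2 * (2 * r * L)) * w y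

    -- b is the access cost paid in the current block, M the moving cost so far.
    record Inv (s : State) (A b M L : ℕ) : Set where
      field
        rounded   : ∀ S → sum (weight s) * access (current s) (proj₁ S) ≤ 2 * r * cost (weight s) S
        potential : Potential (weight s) A L
        positive  : 0 < weight s y
        block≤    : sum (weight s) * b ≤ 2 * r * sum (λ x → weight s x * loss s x)
        -- A reserve of n for each request remaining in the block, the last one included.
        loss≤     : ∀ x → loss s x + n * suc (left s) ≤ B
        b≤        : b + n * suc (left s) ≤ B
        -- Each request served costs the expert at least 1, so before the last request of a block
        -- its loss is at least n².
        loss≥     : n * n ≤ loss s y + left s
        M≤        : M ≤ L

    restart-inv : ∀ {w A M L} → Potential w A L → 0 < w y → M ≤ L → Inv (restart w) A 0 M L
    restart-inv {w} pot pos M≤L = record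
      { rounded   = round-cost w
      ; potential = pot
      ; positive  = pos
      ; block≤    = subst (_≤ 2 * r * sum (λ x → w x * 0)) (sym (*-zeroʳ (sum w))) z≤n
      ; loss≤     = λ _ → ≤-refl
      ; b≤        = ≤-refl
      ; loss≥     = ≤-refl
      ; M≤        = M≤L
      }

    init-inv : Inv init 0 0 0 0
    init-inv = restart-inv pot (s≤s z≤n) z≤n
      where
      pot : Potential (λ _ → 1) 0 0
      pot rewrite *-zeroʳ (2 * r) | sum-const N 1 = ≤-refl

    spend : ∀ {v a} j → v + n * suc j ≤ B → a ≤ n → v + a + n * j ≤ B
    spend {v} {a} j v≤ a≤n = begin
      v + a + n * j   ≤⟨ +-monoˡ-≤ (n * j) (+-monoʳ-≤ v a≤n) ⟩
      v + n + n * j   ≡⟨ regroup v n j ⟩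
      v + n * suc j   ≤⟨ v≤ ⟩
      B               ∎
      where
      regroup : ∀ v n j → v + n + n * j ≡ v + n * suc j
      regroup = solve-∀

    -- As the weights do not change within a block, the rounding guarantees of its requests add up.
    charge-block : ∀ {w v a b} S → sum w * a ≤ 2 * r * cost w S → sum w * b ≤ 2 * r * sum (λ x → w x * v x) →
      sum w * (b + a) ≤ 2 * r * sum (λ x → w x * charge v S x)
    charge-block {w} {v} {a} {b} S wa≤ wb≤ = begin
      sum w * (b + a)                                             ≡⟨ *-distribˡ-+ (sum w) b a ⟩
      sum w * b + sum w * a                                       ≤⟨ +-mono-≤ wb≤ wa≤ ⟩
      2 * r * sum (λ x → w x * v x) + 2 * r * cost w S
        ≡⟨ *-distribˡ-+ (2 * r) (sum (λ x → w x * v x)) (cost w S) ⟨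
      2 * r * (sum (λ x → w x * v x) + cost w S)
        ≡⟨ cong (2 * r *_) (∑.∑-distrib-+ (λ x → w x * v x) (λ x → w x * access (expert x) (proj₁ S))) ⟨
      2 * r * sum (λ x → w x * v x + w x * access (expert x) (proj₁ S))
        ≡⟨ cong (2 * r *_) (∑.sum-cong-≗ (λ x → sym (*-distribˡ-+ (w x) (v x) _))) ⟩
      2 * r * sum (λ x → w x * charge v S x)                      ∎

    -- Exact bookkeeping: A + b + M grows by what the algorithm pays, and L plus the block loss by
    -- what the expert pays. When a block ends, b passes into A and the block loss into L.
    record Step (s : State) (S : Request n r) (A b M L : ℕ) : Set where
      field
        {A′ b′ M′ L′} : ℕ
        inv    : Inv (next s S) A′ b′ M′ L′
        paid   : A + b + M + (access (current s) (proj₁ S) + dKT (current s) (current (next s S))) ≡ A′ + b′ + M′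
        static : L + loss s y + access (expert y) (proj₁ S) ≡ L′ + loss (next s S) y

    next-inv : ∀ s S {A b M L} → Inv s A b M L → Step s S A b M L
    next-inv (state ρ w v (suc j)) S {A} {b} {M} {L} inv = record
      { A′ = A
      ; inv = record
        { rounded   = rounded
        ; potential = potential
        ; positive  = positive
        ; block≤    = charge-block {w} {v} S (rounded S) block≤
        ; loss≤     = λ x → spend (suc j) (loss≤ x) (access≤n (expert x) (nonempty S))
        ; b≤        = spend (suc j) b≤ (access≤n ρ (nonempty S))
        ; loss≥     = begin
            n * n                                    ≤⟨ loss≥ ⟩
            v y + suc j                              ≡⟨ +-suc (v y) j ⟩
            suc (v y) + j                            ≡⟨ cong (_+ j) (+-comm 1 (v y)) ⟩
            v y + 1 + j
              ≤⟨ +-monoˡ-≤ j (+-monoʳ-≤ (v y) (access≥1 (expert y) (nonempty S))) ⟩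
            v y + access (expert y) (proj₁ S) + j    ∎
        ; M≤        = M≤
        }
      ; paid   = trans (cong (λ d → A + b + M + (access ρ (proj₁ S) + d)) (dKT-refl ρ))
                 (regroup A b M (access ρ (proj₁ S)))
      ; static = +-assoc L (v y) _
      }
      where
      open Inv inv
      regroup : ∀ A b M a → A + b + M + (a + 0) ≡ A + (b + a) + M
      regroup = solve-∀
    next-inv (state ρ w v zero) S {A} {b} {M} {L} inv = record
      { A′     = A + (b + access ρ (proj₁ S))
      ; b′     = 0
      ; M′     = M + dKT ρ (round w′)
      ; L′     = L + v′ y
      ; inv    = restart-inv potential′ positive′ M′≤
      ; paid   = regroup A b M (access ρ (proj₁ S)) (dKT ρ (round w′))
      ; static = trans (+-assoc L (v y) _) (sym (+-identityʳ (L + v′ y)))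
      }
      where
      open Inv inv
      v′ w′ : Fin N → ℕ
      v′ = charge v S
      w′ = reweight w v′
      regroup : ∀ A b M a d → A + b + M + (a + d) ≡ A + (b + a) + 0 + (M + d)
      regroup = solve-∀
      v′≤B : ∀ x → v′ x ≤ B
      v′≤B x = m+n≤o⇒m≤o (v′ x) (spend 0 (loss≤ x) (access≤n (expert x) (nonempty S)))
      u≤half : ∀ x → 2 * r * v′ x ≤ half
      u≤half x = *-monoʳ-≤ (2 * r) (v′≤B x)
      positive′ : 0 < w′ y
      positive′ = *-mono-≤ positive (m<n⇒0<n∸m (≤-<-trans (u≤half y) (m<m+n half (≤-trans 0<half (m≤m+n half 0)))))
      potential′ : Potential w′ (A + (b + access ρ (proj₁ S))) (L + v′ y)
      potential′ = subst (λ C → sum w′ * suc K ^ (A + (b + access ρ (proj₁ S))) * K ^ C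
                              ≤ N * K ^ (A + (b + access ρ (proj₁ S))) * suc K ^ C * w′ y)
        (exponent r L (v′ y))
        (potential-step K N A (2 * (2 * r * L)) (b + access ρ (proj₁ S)) (2 * r * v′ y) (*-monoʳ-≤ 2 (u≤half y))
          (reweight-sum K (2 * r) w (λ x → 2 * r * v′ x) v′ (b + access ρ (proj₁ S)) (λ _ → refl)
            (λ x → ≤-trans (u≤half x) (m≤m+n half _)) (charge-block {w} {v} S (rounded S) block≤))
          potential)
        where
        exponent : ∀ r L v → 2 * (2 * r * L) + 2 * (2 * r * v) ≡ 2 * (2 * r * (L + v))
        exponent = solve-∀
      -- The only move of the block costs at most n², which the expert's loss in the block covers.
      M′≤ : M + dKT ρ (round w′) ≤ L + v′ y
      M′≤ = +-mono-≤ M≤ (begin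
        dKT ρ (round w′) ≤⟨ dKT≤n*n ρ (round w′) ⟩
        n * n            ≤⟨ loss≥ ⟩
        v y + 0          ≤⟨ +-monoʳ-≤ (v y) z≤n ⟩
        v′ y             ∎)

    -- The weight of `y` is at most the total, so the potential yields A ≤ 4rL + NK. The unfinished
    -- block adds at most `B` and the moves at most L, which makes the factor 4r + 1.
    inv⇒cost : ∀ {s A b M L} → Inv s A b M L →
      A + b + M ≤ suc (2 * (2 * r)) * (L + loss s y) + (N * K + B)
    inv⇒cost {s} {A} {b} {M} {L} inv = begin
      A + b + M
        ≤⟨ +-mono-≤ (+-mono-≤ A≤ (m+n≤o⇒m≤o b b≤)) M≤ ⟩
      2 * (2 * r * L) + N * K + B + L                             ≡⟨ regroup r L (N * K) B ⟩
      suc (2 * (2 * r)) * L + (N * K + B)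
        ≤⟨ +-monoˡ-≤ (N * K + B) (*-monoʳ-≤ (suc (2 * (2 * r))) (m≤m+n L _)) ⟩
      suc (2 * (2 * r)) * (L + loss s y) + (N * K + B)            ∎
      where
      open Inv inv
      C = 2 * (2 * r * L)
      wᵧ = weight s y
      regroup : ∀ r L k B → 2 * (2 * r * L) + k + B + L ≡ suc (2 * (2 * r)) * L + (k + B)
      regroup = solve-∀
      A≤ : A ≤ C + N * K
      A≤ = exponent-bound K N A C (*-cancelˡ-≤ wᵧ {{>-nonZero positive}} (begin
        wᵧ * (suc K ^ A * K ^ C)            ≡⟨ *-assoc wᵧ (suc K ^ A) (K ^ C) ⟨
        wᵧ * suc K ^ A * K ^ C
          ≤⟨ *-monoˡ-≤ (K ^ C) (*-monoˡ-≤ (suc K ^ A) (term≤sum (weight s) y)) ⟩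
        sum (weight s) * suc K ^ A * K ^ C  ≤⟨ potential ⟩
        N * K ^ A * suc K ^ C * wᵧ          ≡⟨ *-comm _ wᵧ ⟩
        wᵧ * (N * K ^ A * suc K ^ C)        ∎))

    -- Induction on the requests to come, with A + b + M already paid for `hist`. The state folds
    -- over `hist` alone, since `alg` skips the first request `S₀`.
    run-bound : ∀ π₀ q S₀ rest hist {A b M L} → Inv (foldl next init hist) A b M L →
      A + b + M + run alg π₀ q (current (foldl next init hist)) (S₀ ∷ hist) rest
        ≤ suc (2 * (2 * r)) * (L + loss (foldl next init hist) y + staticCost (expert y) rest) + (N * K + B)
    run-bound π₀ q S₀ [] hist {A} {b} {M} {L} inv = begin
      A + b + M + 0                                      ≡⟨ +-identityʳ _ ⟩
      A + b + M                                          ≤⟨ inv⇒cost inv ⟩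
      suc (2 * (2 * r)) * (L + loss s y) + (N * K + B)
        ≡⟨ cong (λ m → suc (2 * (2 * r)) * m + (N * K + B)) (+-identityʳ (L + loss s y)) ⟨
      suc (2 * (2 * r)) * (L + loss s y + 0) + (N * K + B) ∎
      where s = foldl next init hist
    run-bound π₀ q S₀ (S ∷ rest) hist {A} {b} {M} {L} inv = begin
      A + b + M + (access (current s) (proj₁ S) + dKT (current s) (current s″) + R)
        ≡⟨ +-assoc (A + b + M) _ R ⟨
      A + b + M + (access (current s) (proj₁ S) + dKT (current s) (current s″)) + R
        ≡⟨ cong (_+ R) (trans (cong (λ t → A + b + M + (access (current s) (proj₁ S) + dKT (current s) (current t))) s″≡)
             paid) ⟩
      A′ + b′ + M′ + R
        ≤⟨ run-bound π₀ q S₀ rest (hist ++ [ S ]) (subst (λ t → Inv t A′ b′ M′ L′) (sym s″≡) inv′) ⟩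
      suc (2 * (2 * r)) * (L′ + loss s″ y + staticCost (expert y) rest) + (N * K + B)
        ≡⟨ cong (λ m → suc (2 * (2 * r)) * (m + staticCost (expert y) rest) + (N * K + B))
             (trans (cong (λ t → L′ + loss t y) s″≡) (sym static)) ⟩
      suc (2 * (2 * r)) * (L + loss s y + access (expert y) (proj₁ S) + staticCost (expert y) rest) + (N * K + B)
        ≡⟨ cong (λ m → suc (2 * (2 * r)) * m + (N * K + B)) (+-assoc (L + loss s y) _ _) ⟩
      suc (2 * (2 * r)) * (L + loss s y + staticCost (expert y) (S ∷ rest)) + (N * K + B) ∎
      where
      s s″ : State
      s  = foldl next init hist
      s″ = foldl next init (hist ++ [ S ])
      s″≡ : s″ ≡ next s S
      s″≡ = foldl-∷ʳ next init S hist
      open Step (next-inv s S inv) renaming (inv to inv′)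
      R : ℕ
      R = run alg π₀ q (current s″) (S₀ ∷ hist ++ [ S ]) rest

  -- The part n + n² pays for the first request and the move away from π₀, the rest is from
  -- `inv⇒cost`.
  α : ℕ
  α = n + n * n + (N * K + B)

  competitive : ∀ π₀ reqs π → algCost alg π₀ reqs ≤ suc (2 * (2 * r)) * staticCost π reqs + α
  competitive π₀ [] π = z≤n
  competitive π₀ (S ∷ rest) π with y , y≗π ← expert-complete π = begin
    algCost alg π₀ (S ∷ rest)
      ≡⟨ algCost-∷ alg π₀ S rest ⟩
    access π₀ (proj₁ S) + dKT π₀ (current init) + run alg π₀ (S ∷ rest) (current init) [ S ] rest
      ≤⟨ +-mono-≤ (+-mono-≤ (access≤n π₀ (nonempty S)) (dKT≤n*n π₀ (current init)))
                  (run-bound y π₀ (S ∷ rest) S rest [] (init-inv y)) ⟩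
    n + n * n + (suc (2 * (2 * r)) * staticCost (expert y) rest + (N * K + B))
      ≡⟨ regroup (n + n * n) (suc (2 * (2 * r)) * staticCost (expert y) rest) (N * K + B) ⟩
    suc (2 * (2 * r)) * staticCost (expert y) rest + α
      -- The expert agrees with `π` pointwise, which suffices for equal access costs; the static
      -- cost of the first request is added as slack.
      ≤⟨ +-monoˡ-≤ α (*-monoʳ-≤ (suc (2 * (2 * r))) (≤-trans
           (staticCost-cong (expert y) π (λ T → access-mono (expert y) π (λ e →
             ≤-reflexive (cong (suc ∘ toℕ) (y≗π e))) (nonempty T)) rest)
           (m≤n+m _ (access π (proj₁ S))))) ⟩
    suc (2 * (2 * r)) * staticCost π (S ∷ rest) + α ∎
    where
    regroup : ∀ x y z → x + (y + z) ≡ y + (x + z)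
    regroup = solve-∀

theorem2 : (n r : ℕ) → 1 ≤ n → 1 ≤ r → r ≤ n →
    Σ (OnlineAlg n r) (λ A → Σ ℕ (λ α →
    (π₀ : Perm n) (reqs : List (Request n r)) (π : Perm n) →
    algCost A π₀ reqs ≤ (5 * r + 2) * staticCost π reqs + α))
theorem2 n r 1≤n 1≤r r≤n = alg , α , λ π₀ reqs π →
  ≤-trans (competitive π₀ reqs π) (+-monoˡ-≤ α (*-monoˡ-≤ (staticCost π reqs) ratio))
  where
  open MultiplicativeWeights n r 1≤n 1≤r
  -- The analysis gives 4r + 1, which leaves a slack of r + 1.
  ratio : suc (2 * (2 * r)) ≤ 5 * r + 2
  ratio = ≤-trans (m≤m+n (suc (2 * (2 * r))) (suc r)) (≤-reflexive (regroup r))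
    where
    regroup : ∀ r → suc (2 * (2 * r)) + suc r ≡ 5 * r + 2
    regroup = solve-∀
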